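{- Every simple edge-colored graph on $n$ vertices with at least $n$ color classes, each containing at least $0.3988\,n$ edges, contains a rainbow triangle.
   Context: An edge-coloring of a graph $G$ is an arbitrary map $f:E(G)\to\mathbb{N}$ (not necessarily proper); for a color $i$, the set $f^{ -1}(i)$ is the color class of $i$. A rainbow triangle is a triangle in $G$ whose three edges have pairwise distinct colors. A graph is simple if it has no loops or parallel edges. (In the paper's terminology, $(1,0.3988)$ is "triangular", where $(\alpha,\beta)$ is triangular if every simple edge-colored graph on $n$ vertices with at least $\alpha n$ color classes, each with at least $\beta n$ edges, has a rainbow triangle.) -}

module Defs where

open import Data.Nat using (ℕ; _<_; _≤_; _*_; _≟_; _<?_)
open import Data.Bool using (Bool; true; false; _∧_)
open import Data.Fin using (Fin; toℕ)
open import Data.List using (List; length; filter; allFin; cartesianProduct)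
open import Data.Product using (_×_; _,_; Σ; ∃; proj₁; proj₂)
open import Relation.Nullary using (¬_; Dec; yes; no)
open import Relation.Nullary.Decidable using (⌊_⌋)
open import Relation.Binary.PropositionalEquality using (_≡_; _≢_)
open import Function.Definitions using (Injective)

record SimpleGraph (n : ℕ) : Set where
  field
    Adj : Fin n → Fin n → Bool
    sym : ∀ i j → Adj i j ≡ Adj j i
    loopless : ∀ i → Adj i i ≡ false
open SimpleGraph public

-- An edge-coloring f : E(G) → ℕ (arbitrary, not necessarily proper).
-- Represented as a symmetric function on vertex pairs; its values on
-- non-adjacent pairs are irrelevant.
record EdgeColoring {n : ℕ} (G : SimpleGraph n) : Set where
  field
    col : Fin n → Fin n → ℕ
    col-sym : ∀ i j → Adj G i j ≡ true → col i j ≡ col j i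
open EdgeColoring public

edges : ∀ {n} → SimpleGraph n → List (Fin n × Fin n)
edges {n} G = filter (λ p → Dec-edge p) (cartesianProduct (allFin n) (allFin n))
  where
  Dec-edge : (p : Fin n × Fin n) → Dec (toℕ (proj₁ p) < toℕ (proj₂ p) × Adj G (proj₁ p) (proj₂ p) ≡ true)
  Dec-edge (i , j) with toℕ i <? toℕ j | Adj G i j
  ... | yes p | true  = yes (p , _≡_.refl)
  ... | yes p | false = no (λ { (_ , ()) })
  ... | no ¬p | _     = no (λ q → ¬p (proj₁ q))

classSize : ∀ {n} {G : SimpleGraph n} → EdgeColoring G → ℕ → ℕ
classSize {G = G} f c = length (filter (λ p → col f (proj₁ p) (proj₂ p) ≟ c) (edges G))

RainbowTriangle : ∀ {n} {G : SimpleGraph n} → EdgeColoring G → Set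
RainbowTriangle {n} {G} f =
  Σ (Fin n) λ a → Σ (Fin n) λ b → Σ (Fin n) λ c →
    Adj G a b ≡ true × Adj G b c ≡ true × Adj G a c ≡ true ×
    col f a b ≢ col f b c × col f b c ≢ col f a c × col f a b ≢ col f a c

{-# OPTIONS --safe #-}

-- Truncate every class to the same number m of edges and suppose that there is no rainbow triangle.
-- Every triangle then contains a monochromatic cherry, and a class of m edges has at most m(m-1)/2
-- cherries, while Goodman's identity bounds the number of triangles from below.  For m = 2n/5 the
-- two counts meet.  For m slightly below 2n/5 their difference is a small multiple of n³, which
-- bounds the sum of three nonnegative defects: the variance V of the degrees, the number I of pairs
-- (edge, common non-neighbour of its ends), and the number of missing or open cherries (cherries
-- whose ends are not adjacent).
--
-- Some class is then nearly a star whose leaf set L, of size about 2n/5, is nearly a clique.  A vertex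
-- has about n/5 non-neighbours, so by Cauchy–Schwarz many pairs in L have a common non-neighbour;
-- most of these pairs are edges, and I is larger than the difference allows.
module Submission where

open import Defs hiding (sym)
open import Data.Bool using (true)
import Data.Bool.Properties as Bool
open import Data.Nat as ℕ using (ℕ; zero; suc; NonZero)
import Data.Nat.Properties as ℕ
open import Data.Fin using (Fin; zero; suc; _≟_; toℕ)
open import Data.Fin.Properties using (suc-injective; any?)
open import Data.Integer
  using (ℤ; +_; -[1+_]; 0ℤ; 1ℤ; _+_; _-_; _*_; -_; _≤_; _<_; +≤+; +<+; _≤?_; nonNegative; positive)
open import Data.Integer.Properties hiding (_≟_)
open import Data.Integer.Tactic.RingSolver using (solve-∀)
open import Data.List using (List; []; _∷_; length; filter; take; allFin; cartesianProduct)
open import Data.List.Properties using (length-take)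
open import Data.List.Membership.Propositional using (_∈_)
open import Data.List.Relation.Unary.All as All using (All; []; _∷_)
import Data.List.Relation.Unary.All.Properties as All
open import Data.List.Relation.Unary.AllPairs using ([]; _∷_)
open import Data.List.Relation.Unary.Any using (here; there)
open import Data.List.Relation.Unary.Unique.Propositional using (Unique)
import Data.List.Relation.Unary.Unique.Propositional.Properties as Unique
open import Data.Product using (∃; _,_; _×_; uncurry; proj₁; proj₂)
open import Data.Sum using (_⊎_; inj₁; inj₂) renaming (map to ⊎-map)
open import Data.Empty using (⊥; ⊥-elim)
open import Data.Unit using (tt)
open import Function using (_∘_; id)
open import Function.Definitions using (Injective)
open import Relation.Nullary using (Dec; yes; no; ¬_)
open import Relation.Nullary.Decidable using (_×-dec_; ¬?; decidable-stable)
open import Relation.Binary.PropositionalEquality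
  using (_≡_; _≢_; refl; sym; trans; cong; cong₂; subst; subst₂)
open import Algebra.Properties.Semiring.Sum +-*-semiring
  using (sum; sum-syntax; sum-cong-≗; ∑-distrib-+; ∑-comm; *-distribˡ-sum; *-distribʳ-sum)

-- Inequalities and finite sums over the integers

infixl 6 _+⁺_
infixl 7 _*⁺_

-- Proofs of nonnegativity are combined by the same operators as the terms they concern, so that a
-- certificate reads like its polynomial.
_+⁺_ : ∀ {a b} → 0ℤ ≤ a → 0ℤ ≤ b → 0ℤ ≤ a + b
_+⁺_ = +-mono-≤

_*⁺_ : ∀ {a b} → 0ℤ ≤ a → 0ℤ ≤ b → 0ℤ ≤ a * b
_*⁺_ {+ a} {+ b} _ _ = subst (0ℤ ≤_) (pos-* a b) (+≤+ ℕ.z≤n)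

square≥0 : ∀ a → 0ℤ ≤ a * a
square≥0 (+ a) = _*⁺_ {+ a} {+ a} (+≤+ ℕ.z≤n) (+≤+ ℕ.z≤n)
square≥0 -[1+ a ] = +≤+ ℕ.z≤n

lit≥0 : ∀ {k} → 0ℤ ≤ + k
lit≥0 = +≤+ ℕ.z≤n

lit>0 : ∀ {k} → 0ℤ < + suc k
lit>0 = +<+ (ℕ.s≤s ℕ.z≤n)

-- Splits an inequality into a nonnegative expression for the difference and a polynomial identity,
-- which is left to the ring solver.
≤-by : ∀ {a b c} → 0ℤ ≤ c → c ≡ b - a → a ≤ b
≤-by p refl = 0≤i-j⇒j≤i p

diff≥0 : ∀ {a b} → a ≤ b → 0ℤ ≤ b - a
diff≥0 = i≤j⇒0≤j-i

∑-mono : ∀ {n} {f g : Fin n → ℤ} → (∀ i → f i ≤ g i) → sum f ≤ sum g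
∑-mono {zero} p = ≤-refl
∑-mono {suc n} p = +-mono-≤ (p zero) (∑-mono (p ∘ suc))

∑-const : ∀ n c → ∑[ i < n ] c ≡ + n * c
∑-const zero c = refl
∑-const (suc n) c = trans (cong (_+_ c) (∑-const n c)) (sym (suc-* (+ n) c))

∑≥0 : ∀ {n} {f : Fin n → ℤ} → (∀ i → 0ℤ ≤ f i) → 0ℤ ≤ sum f
∑≥0 {zero} p = ≤-refl
∑≥0 {suc n} p = p zero +⁺ ∑≥0 (p ∘ suc)

term≤∑ : ∀ {n} {f : Fin n → ℤ} → (∀ i → 0ℤ ≤ f i) → ∀ i → f i ≤ sum f
term≤∑ {suc n} {f} p zero = subst (_≤ sum f) (+-identityʳ _) (+-monoʳ-≤ (f zero) (∑≥0 (p ∘ suc)))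
term≤∑ {suc n} {f} p (suc i) = subst (_≤ sum f) (+-identityˡ _) (+-mono-≤ (p zero) (term≤∑ (p ∘ suc) i))

-- The averaging principle; it selects first a colour and then the centre of a star.
∃-positive-term : ∀ {n} (f : Fin n → ℤ) → 0ℤ < sum f → ∃ λ i → 0ℤ < f i
∃-positive-term {zero} f (+<+ ())
∃-positive-term {suc n} f p with f zero ≤? 0ℤ
... | no q = zero , ≰⇒> q
... | yes q with ∃-positive-term (f ∘ suc)
    (<-≤-trans p (subst (sum f ≤_) (+-identityˡ _) (+-monoˡ-≤ _ q)))
...   | i , r = suc i , r

∑-neg : ∀ {n} (f : Fin n → ℤ) → ∑[ i < n ] (- f i) ≡ - sum f
∑-neg {zero} f = refl
∑-neg {suc n} f = trans (cong (_+_ (- f zero)) (∑-neg (f ∘ suc))) (sym (neg-distrib-+ (f zero) _))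

∑-- : ∀ {n} (f g : Fin n → ℤ) → ∑[ i < n ] (f i - g i) ≡ sum f - sum g
∑-- f g = trans (∑-distrib-+ f (λ i → - g i)) (cong (_+_ (sum f)) (∑-neg g))

∑-alternating : ∀ {n} (f g h k : Fin n → ℤ) →
  ∑[ i < n ] (f i - g i - h i + k i) ≡ sum f - sum g - sum h + sum k
∑-alternating f g h k =
  trans (∑-distrib-+ (λ i → f i - g i - h i) k)
  (cong (_+ sum k) (trans (∑-- (λ i → f i - g i) h) (cong (_- sum h) (∑-- f g))))

∑-*ˡ : ∀ {n} c (f : Fin n → ℤ) → ∑[ i < n ] (c * f i) ≡ c * sum f
∑-*ˡ c f = sym (*-distribˡ-sum c f)

∑-*ʳ : ∀ {n} c (f : Fin n → ℤ) → ∑[ i < n ] (f i * c) ≡ sum f * c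
∑-*ʳ c f = sym (*-distribʳ-sum c f)

∑∑-* : ∀ {n} (f g : Fin n → ℤ) → ∑[ i < n ] ∑[ j < n ] (f i * g j) ≡ sum f * sum g
∑∑-* f g = trans (sum-cong-≗ (λ i → ∑-*ˡ (f i) g)) (∑-*ʳ (sum g) f)

-- Degrees in a single colour class

Binary : ℤ → Set
Binary a = a ≡ 0ℤ ⊎ a ≡ 1ℤ

binary≥0 : ∀ {a} → Binary a → 0ℤ ≤ a
binary≥0 (inj₁ refl) = lit≥0
binary≥0 (inj₂ refl) = lit≥0

binary≤1 : ∀ {a} → Binary a → a ≤ 1ℤ
binary≤1 (inj₁ refl) = lit≥0
binary≤1 (inj₂ refl) = ≤-refl

binary-idem : ∀ {a} → Binary a → a * a ≡ a
binary-idem (inj₁ refl) = refl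
binary-idem (inj₂ refl) = refl

δ : ∀ {n} → Fin n → Fin n → ℤ
δ zero zero = 1ℤ
δ zero (suc j) = 0ℤ
δ (suc i) zero = 0ℤ
δ (suc i) (suc j) = δ i j

δ-diag : ∀ {n} (i : Fin n) → δ i i ≡ 1ℤ
δ-diag zero = refl
δ-diag (suc i) = δ-diag i

δ-off : ∀ {n} {i j : Fin n} → i ≢ j → δ i j ≡ 0ℤ
δ-off {i = zero} {zero} p = ⊥-elim (p refl)
δ-off {i = zero} {suc j} p = refl
δ-off {i = suc i} {zero} p = refl
δ-off {i = suc i} {suc j} p = δ-off (p ∘ cong suc)

∑-zero : ∀ {n} {f : Fin n → ℤ} → (∀ i → f i ≡ 0ℤ) → sum f ≡ 0ℤ
∑-zero {zero} p = refl
∑-zero {suc n} p = cong₂ _+_ (p zero) (∑-zero (p ∘ suc))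

∑-δ : ∀ {n} (i : Fin n) (f : Fin n → ℤ) → ∑[ j < n ] (δ i j * f j) ≡ f i
∑-δ zero f = trans (cong₂ _+_ (*-identityˡ (f zero)) (∑-zero {f = λ j → 0ℤ * f (suc j)} (λ _ → refl)))
    (+-identityʳ (f zero))
∑-δ (suc i) f = trans (+-identityˡ _) (∑-δ i (f ∘ suc))

∑-δ+δ : ∀ {n} (a b : Fin n) (f : Fin n → ℤ) → ∑[ j < n ] ((δ a j + δ b j) * f j) ≡ f a + f b
∑-δ+δ a b f =
  trans (sum-cong-≗ (λ j → *-distribʳ-+ (f j) (δ a j) (δ b j)))
  (trans (∑-distrib-+ (λ j → δ a j * f j) (λ j → δ b j * f j)) (cong₂ _+_ (∑-δ a f) (∑-δ b f)))

∑-δ+δ+δ : ∀ {n} (a b c : Fin n) (f : Fin n → ℤ) → ∑[ j < n ] ((δ a j + δ b j + δ c j) * f j)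
    ≡ f a + f b + f c
∑-δ+δ+δ a b c f =
  trans (sum-cong-≗ (λ j → *-distribʳ-+ (f j) (δ a j + δ b j) (δ c j)))
  (trans (∑-distrib-+ (λ j → (δ a j + δ b j) * f j) (λ j → δ c j * f j))
      (cong₂ _+_ (∑-δ+δ a b f) (∑-δ c f)))

δ+δ≤1 : ∀ {n} {a b : Fin n} → a ≢ b → ∀ x → δ a x + δ b x ≤ 1ℤ
δ+δ≤1 {a = a} {b} a≢b x with a ≟ x | b ≟ x
... | yes refl | _ rewrite δ-diag a | δ-off (a≢b ∘ sym) = ≤-refl
... | no p | yes refl rewrite δ-off p | δ-diag b = ≤-refl
... | no p | no q rewrite δ-off p | δ-off q = lit≥0

δ+δ+δ≤1 : ∀ {n} {a b c : Fin n} → a ≢ b → a ≢ c → b ≢ c → ∀ x → δ a x + δ b x + δ c x ≤ 1ℤ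
δ+δ+δ≤1 {a = a} {b} {c} a≢b a≢c b≢c x with c ≟ x
... | yes refl rewrite δ-off a≢c | δ-off b≢c | δ-diag c = ≤-refl
... | no p rewrite δ-off p = subst (_≤ 1ℤ) (sym (+-identityʳ _)) (δ+δ≤1 a≢b x)

degree : ∀ {n} → (Fin n → Fin n → ℤ) → Fin n → ℤ
degree {n} M x = ∑[ y < n ] M x y

module ClassBounds {n : ℕ} (M : Fin n → Fin n → ℤ) (m : ℤ)
  (binary : ∀ x y → Binary (M x y))
  (symmetric : ∀ x y → M x y ≡ M y x)
  (irreflexive : ∀ x → M x x ≡ 0ℤ)
  (total : ∑[ x < n ] degree M x ≡ + 2 * m)
  where

  e : Fin n → ℤ
  e = degree M

  squares : ℤ
  squares = ∑[ x < n ] (e x * e x)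

  M≥0 : ∀ x y → 0ℤ ≤ M x y
  M≥0 x y = binary≥0 (binary x y)

  e≥0 : ∀ x → 0ℤ ≤ e x
  e≥0 x = ∑≥0 (M≥0 x)

  ∑∑-target : ∀ (s : Fin n → ℤ) → ∑[ x < n ] ∑[ y < n ] (s y * M x y) ≡ ∑[ x < n ] (s x * e x)
  ∑∑-target s =
    trans (∑-comm (λ x y → s y * M x y))
      (sum-cong-≗ (λ y → trans (∑-*ˡ (s y) (λ x → M x y))
          (cong (s y *_) (sum-cong-≗ (λ x → symmetric x y)))))

  -- Edges meeting a vertex set with indicator s, counted by inclusion–exclusion.
  incident-edges : ∀ (s : Fin n → ℤ) → (∀ x → s x ≤ 1ℤ) →
    + 2 * (∑[ x < n ] (s x * e x)) ≤ + 2 * m + ∑[ x < n ] (s x * (∑[ y < n ] (s y * M x y)))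
  incident-edges s s≤1 = ≤-by
    (∑≥0 (λ x → ∑≥0 (λ y → M≥0 x y *⁺ (diff≥0 (s≤1 x) *⁺ diff≥0 (s≤1 y)))))
    (trans outer (rearrange m (∑[ x < n ] (s x * e x)) _))
    where
    r : Fin n → ℤ
    r x = ∑[ y < n ] (s y * M x y)
    expand : ∀ a b c → a * ((1ℤ - b) * (1ℤ - c)) ≡ a - b * a - c * a + b * (c * a)
    expand = solve-∀
    rearrange : ∀ a b c → + 2 * a - b - b + c ≡ (+ 2 * a + c) - + 2 * b
    rearrange = solve-∀
    inner : ∀ x → ∑[ y < n ] (M x y * ((1ℤ - s x) * (1ℤ - s y))) ≡ e x - s x * e x - r x + s x * r x
    inner x =
      trans (sum-cong-≗ (λ y → expand (M x y) (s x) (s y)))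
      (trans (∑-alternating (M x) (λ y → s x * M x y) (λ y → s y * M x y) (λ y → s x * (s y * M x y)))
        (cong₂ (λ u v → e x - u - r x + v) (∑-*ˡ (s x) (M x)) (∑-*ˡ (s x) (λ y → s y * M x y))))
    outer : ∑[ x < n ] ∑[ y < n ] (M x y * ((1ℤ - s x) * (1ℤ - s y)))
      ≡ + 2 * m - ∑[ x < n ] (s x * e x) - ∑[ x < n ] (s x * e x) + ∑[ x < n ] (s x * r x)
    outer =
      trans (sum-cong-≗ inner)
      (trans (∑-alternating e (λ x → s x * e x) r (λ x → s x * r x))
        (cong₂ (λ u v → u - ∑[ x < n ] (s x * e x) - v + ∑[ x < n ] (s x * r x)) total (∑∑-target s)))

  -- Among the m edges only `ab` can be counted at both vertices. For a triple, in `degree-triple`,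
  -- up to three edges are counted twice.
  degree-pair : ∀ {a b} → a ≢ b → e a + e b ≤ m + 1ℤ
  degree-pair {a} {b} a≢b =
    *-cancelˡ-≤-pos _ _ (+ 2) (≤-trans (subst₂ _≤_ (cong (_*_ (+ 2)) (∑-δ+δ a b e))
        (cong (_+_ (+ 2 * m)) quad) (incident-edges (λ x → δ a x + δ b x) (δ+δ≤1 a≢b)))
            (≤-by (lit≥0 {2} *⁺ diff≥0 (binary≤1 (binary a b))) (arith m (M a b))))
    where
    arith : ∀ m x → + 2 * (1ℤ - x) ≡ + 2 * (m + 1ℤ) - (+ 2 * m + + 2 * x)
    arith = solve-∀
    collect : ∀ x → 0ℤ + x + (x + 0ℤ) ≡ + 2 * x
    collect = solve-∀
    quad : ∑[ x < n ] ((δ a x + δ b x) * (∑[ y < n ] ((δ a y + δ b y) * M x y))) ≡ + 2 * M a b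
    quad = trans (sum-cong-≗ (λ x → cong ((δ a x + δ b x) *_) (∑-δ+δ a b (M x))))
      (trans (∑-δ+δ a b (λ x → M x a + M x b))
      (trans (cong₂ _+_ (cong₂ _+_ (irreflexive a) refl) (cong₂ _+_ (symmetric b a) (irreflexive b)))
          (collect (M a b))))

  degree-triple : ∀ {a b c} → a ≢ b → a ≢ c → b ≢ c → e a + e b + e c ≤ m + + 3
  degree-triple {a} {b} {c} a≢b a≢c b≢c =
    *-cancelˡ-≤-pos _ _ (+ 2) (≤-trans
      (subst₂ _≤_ (cong (_*_ (+ 2)) (∑-δ+δ+δ a b c e)) (cong (_+_ (+ 2 * m)) quad)
        (incident-edges (λ x → δ a x + δ b x + δ c x) (δ+δ+δ≤1 a≢b a≢c b≢c)))
      (≤-by (lit≥0 {2} *⁺ (diff≥0 (binary≤1 (binary a b)) +⁺ diff≥0 (binary≤1 (binary a c))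
          +⁺ diff≥0 (binary≤1 (binary b c))))
        (arith m (M a b) (M a c) (M b c))))
    where
    arith : ∀ m x y z → + 2 * ((1ℤ - x) + (1ℤ - y) + (1ℤ - z))
        ≡ + 2 * (m + + 3) - (+ 2 * m + + 2 * (x + y + z))
    arith = solve-∀
    collect : ∀ x y z → 0ℤ + x + y + (x + 0ℤ + z) + (y + z + 0ℤ) ≡ + 2 * (x + y + z)
    collect = solve-∀
    quad : ∑[ x < n ] ((δ a x + δ b x + δ c x) * (∑[ y < n ] ((δ a y + δ b y + δ c y) * M x y)))
        ≡ + 2 * (M a b + M a c + M b c)
    quad = trans (sum-cong-≗ (λ x → cong ((δ a x + δ b x + δ c x) *_) (∑-δ+δ+δ a b c (M x))))
      (trans (∑-δ+δ+δ a b c (λ x → M x a + M x b + M x c))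
      (trans (cong₂ _+_ (cong₂ _+_ (cong (λ t → t + M a b + M a c) (irreflexive a))
                                   (cong₂ (λ s t → s + t + M b c) (symmetric b a) (irreflexive b)))
                        (cong₂ _+_ (cong₂ _+_ (symmetric c a) (symmetric c b)) (irreflexive c)))
        (collect (M a b) (M a c) (M b c))))

  edge-sum : ∑[ x < n ] ∑[ y < n ] (M x y * (e x + e y)) ≡ + 2 * squares
  edge-sum =
    trans (sum-cong-≗ (λ x → trans (sum-cong-≗ (λ y → split (M x y) (e x) (e y)))
      (trans (∑-distrib-+ (λ y → e x * M x y) (λ y → e y * M x y))
          (cong (_+ ∑[ y < n ] (e y * M x y)) (∑-*ˡ (e x) (M x))))))
    (trans (∑-distrib-+ (λ x → e x * e x) (λ x → ∑[ y < n ] (e y * M x y)))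
    (trans (cong (_+_ squares) (∑∑-target e)) (double squares)))
    where
    split : ∀ a b c → a * (b + c) ≡ b * a + c * a
    split = solve-∀
    double : ∀ a → a + a ≡ + 2 * a
    double = solve-∀

  -- By `edge-sum`, `squares` is the sum of `e x + e y` over the m edges, and `degree-pair` bounds
  -- each summand. A star attains equality.
  squares≤ : squares ≤ m * (m + 1ℤ)
  squares≤ = *-cancelˡ-≤-pos _ _ (+ 2) (subst₂ _≤_ edge-sum
    (trans (sum-cong-≗ (λ x → ∑-*ʳ (m + 1ℤ) (M x)))
        (trans (∑-*ʳ (m + 1ℤ) e) (trans (cong (_* (m + 1ℤ)) total) (*-assoc (+ 2) m (m + 1ℤ)))))
    (∑-mono (λ x → ∑-mono (λ y → bound x y))))
    where
    bound : ∀ x y → M x y * (e x + e y) ≤ M x y * (m + 1ℤ)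
    bound x y with binary x y
    ... | inj₁ p rewrite p = ≤-refl
    ... | inj₂ p rewrite p | *-identityˡ (e x + e y) | *-identityˡ (m + 1ℤ) =
      degree-pair (λ { refl → case-⊥ (trans (sym (irreflexive x)) p) })
      where
      case-⊥ : 0ℤ ≡ 1ℤ → ⊥
      case-⊥ ()

  -- An edge avoiding v meets at most two of the edges at v.
  squares≤star : ∀ v → squares ≤ m * (m + 1ℤ) - (m - e v) * (e v - + 2)
  squares≤star v = *-cancelˡ-≤-pos _ _ (+ 2) (subst₂ _≤_ edge-sum evaluate
    (∑-mono (λ x → ∑-mono (λ y → bound x y))))
    where
    D = e v - + 2
    -- On an edge the factor `1ℤ - δ v x - δ v y` is 0 if v is an end and 1 otherwise. One formula
    -- thus covers `degree-pair` at v and `degree-triple` away from v, and it can be summed in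
    -- closed form.
    bound : ∀ x y → M x y * (e x + e y) ≤ M x y * ((m + 1ℤ) - D * (1ℤ - δ v x - δ v y))
    bound x y with binary x y
    ... | inj₁ p rewrite p = ≤-refl
    ... | inj₂ p rewrite p | *-identityˡ (e x + e y) | *-identityˡ ((m + 1ℤ) - D * (1ℤ - δ v x - δ v y))
        = edge
      where
      x≢y : x ≢ y
      x≢y refl with trans (sym (irreflexive x)) p
      ... | ()
      at-v : ∀ m d → m ≡ m - d * 0ℤ
      at-v = solve-∀
      off-v : ∀ m x y v → (m + + 3) - (x + y + v) ≡ ((m + 1ℤ) - (v - + 2) * (1ℤ - 0ℤ - 0ℤ)) - (x + y)
      off-v = solve-∀
      edge : e x + e y ≤ (m + 1ℤ) - D * (1ℤ - δ v x - δ v y)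
      edge with v ≟ x | v ≟ y
      ... | yes refl | _ rewrite δ-diag v | δ-off x≢y =
          subst (e x + e y ≤_) (at-v (m + 1ℤ) D) (degree-pair x≢y)
      ... | no q | yes refl rewrite δ-diag v | δ-off q =
          subst (e x + e y ≤_) (at-v (m + 1ℤ) D) (degree-pair x≢y)
      ... | no q | no r rewrite δ-off q | δ-off r =
          ≤-by (diff≥0 (degree-triple x≢y (q ∘ sym) (r ∘ sym))) (off-v m (e x) (e y) (e v))
    distribute : ∀ a b d p q → a * (b - d * (1ℤ - p - q)) ≡ (b - d * (1ℤ - p)) * a + d * (q * a)
    distribute = solve-∀
    row : ∀ b d p s r → (b - d * (1ℤ - p)) * s + d * r ≡ (b - d) * s + d * (p * s + r)
    row = solve-∀
    final : ∀ m v → (m + 1ℤ - (v - + 2)) * (+ 2 * m) + (v - + 2) * (v + v)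
        ≡ + 2 * (m * (m + 1ℤ) - (m - v) * (v - + 2))
    final = solve-∀
    evaluate : ∑[ x < n ] ∑[ y < n ] (M x y * ((m + 1ℤ) - D * (1ℤ - δ v x - δ v y)))
        ≡ + 2 * (m * (m + 1ℤ) - (m - e v) * D)
    evaluate =
      trans (sum-cong-≗ (λ x →
        trans (sum-cong-≗ (λ y → distribute (M x y) (m + 1ℤ) D (δ v x) (δ v y)))
        (trans (∑-distrib-+ (λ y → ((m + 1ℤ) - D * (1ℤ - δ v x)) * M x y) (λ y → D * (δ v y * M x y)))
        (trans (cong₂ _+_ (∑-*ˡ ((m + 1ℤ) - D * (1ℤ - δ v x)) (M x)) (∑-*ˡ D (λ y → δ v y * M x y)))
          (row (m + 1ℤ) D (δ v x) (e x) (∑[ y < n ] (δ v y * M x y)))))))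
      (trans (∑-distrib-+ (λ x → (m + 1ℤ - D) * e x)
          (λ x → D * (δ v x * e x + ∑[ y < n ] (δ v y * M x y))))
      (trans (cong₂ _+_ (trans (∑-*ˡ (m + 1ℤ - D) e) (cong ((m + 1ℤ - D) *_) total))
        (trans (∑-*ˡ D (λ x → δ v x * e x + ∑[ y < n ] (δ v y * M x y)))
          (cong (D *_) (trans (∑-distrib-+ (λ x → δ v x * e x) (λ x → ∑[ y < n ] (δ v y * M x y)))
            (cong₂ _+_ (∑-δ v e) (trans (∑∑-target (δ v)) (∑-δ v e)))))))
        (final m (e v))))

-- Applied to the colours of a vertex pair, this makes the adjacency matrix `A` below a 0/1 matrix
-- and recovers the colour of each edge.
∑-binary-unique : ∀ {n} (f : Fin n → ℤ) → (∀ i → Binary (f i)) → (∀ i j → f i ≡ 1ℤ → f j ≡ 1ℤ → i ≡ j) →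
  sum f ≡ 0ℤ ⊎ (sum f ≡ 1ℤ × ∃ λ i → f i ≡ 1ℤ)
∑-binary-unique {zero} f _ _ = inj₁ refl
∑-binary-unique {suc n} f binary unique with binary zero
... | inj₂ p = inj₂ (cong₂ _+_ p (∑-zero rest) , zero , p)
  where
  rest : ∀ i → f (suc i) ≡ 0ℤ
  rest i with binary (suc i)
  ... | inj₁ q = q
  ... | inj₂ q with unique zero (suc i) p q
  ...   | ()
... | inj₁ p with ∑-binary-unique (f ∘ suc) (binary ∘ suc)
    (λ i j q r → suc-injective (unique (suc i) (suc j) q r))
...   | inj₁ q = inj₁ (cong₂ _+_ p q)
...   | inj₂ (q , i , r) = inj₂ (cong₂ _+_ p q , suc i , r)

∑-rotate : ∀ {a b c} (f : Fin a → Fin b → Fin c → ℤ) →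
  ∑[ x < a ] ∑[ y < b ] ∑[ z < c ] f x y z ≡ ∑[ z < c ] ∑[ x < a ] ∑[ y < b ] f x y z
∑-rotate f = trans (sum-cong-≗ (λ x → ∑-comm (f x))) (∑-comm (λ x z → sum (λ y → f x y z)))

-- Numerical estimates

≥0-cancel : ∀ {a b} → 0ℤ < a → 0ℤ ≤ a * b → 0ℤ ≤ b
≥0-cancel {a} {b} a>0 ab≥0 = *-cancelˡ-≤-pos 0ℤ b a ⦃ positive a>0 ⦄
    (subst (_≤ a * b) (sym (*-zeroʳ a)) ab≥0)

>0-cancel : ∀ {a b} → 0ℤ ≤ a → 0ℤ < a * b → 0ℤ < b
>0-cancel {a} {b} a≥0 ab>0 = *-cancelˡ-<-nonNeg a ⦃ nonNegative a≥0 ⦄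
    (subst (_< a * b) (sym (*-zeroʳ a)) ab>0)

pos-pos : ∀ {a b} → 0ℤ < a → 0ℤ < b → 0ℤ < a * b
pos-pos {a} {b} a>0 b>0 = subst (_< a * b) (*-zeroʳ a) (*-monoˡ-<-pos a ⦃ positive a>0 ⦄ b>0)

-- Since 2·163 = 5·65 + 1, the class size 65n/163 forces 2n - 5m ≤ m/65. This makes the bound of
-- `total-deficit` small compared with nm².
large-class : ∀ {n m} → 0ℤ ≤ + 163 * m - + 65 * n → + 65 * (+ 2 * n - + 5 * m - + 3) ≤ m - + 195
large-class {n} {m} a = ≤-by (lit≥0 {2} *⁺ a) (arith n m)
  where
  arith : ∀ n m → + 2 * (+ 163 * m - + 65 * n) ≡ (m - + 195) - + 65 * (+ 2 * n - + 5 * m - + 3)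
  arith = solve-∀

-- The bound of squares≤star is convex in Δ and too small at both Δ = 2m/5 and Δ = 4m/5.
star-arithmetic : ∀ {m b δ Δ} → 0ℤ < m → 0ℤ ≤ m - + 195 - + 65 * b → 0ℤ ≤ m * b - + 3 * δ → 0ℤ ≤ b →
  0ℤ ≤ + 5 * Δ - + 2 * m → 0ℤ ≤ δ - (m - Δ) * (Δ - + 2) → + 4 * m ≤ + 5 * Δ
star-arithmetic {m} {b} {δ} {Δ} m>0 c s b≥0 u t with + 4 * m ≤? + 5 * Δ
... | yes p = p
... | no p = ⊥-elim (<-irrefl refl (≤-<-trans nonneg negative))
  where
  w : 0ℤ ≤ + 4 * m - + 5 * Δ
  w = diff≥0 (<⇒≤ (≰⇒> p))
  m≥0 : 0ℤ ≤ m
  m≥0 = <⇒≤ m>0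
  2m≥10 : 0ℤ ≤ + 2 * m - + 10
  2m≥10 = subst (0ℤ ≤_) (arith m b) (lit≥0 {2} *⁺ (c +⁺ lit≥0 {65} *⁺ b≥0) +⁺ lit≥0 {380})
    where
    arith : ∀ m b → + 2 * (m - + 195 - + 65 * b + + 65 * b) + + 380 ≡ + 2 * m - + 10
    arith = solve-∀
  -- Each summand is a product of quantities known to be nonnegative. The product of the two range
  -- conditions on Δ cancels the term in Δ²; then b, δ and Δ all drop out and a negative polynomial
  -- in m remains.
  X : ℤ
  X = + 65 * (+ 75 * (δ - (m - Δ) * (Δ - + 2)) + + 25 * (m * b - + 3 * δ)
        + + 3 * ((+ 4 * m - + 5 * Δ) * (+ 5 * Δ - + 2 * m) + (+ 4 * m - + 5 * Δ) * (+ 2 * m - + 10)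
            + m * (+ 5 * Δ - + 2 * m)))
      + + 25 * (m * (m - + 195 - + 65 * b))
  nonneg : 0ℤ ≤ X
  nonneg = lit≥0 {65} *⁺ (lit≥0 {75} *⁺ t +⁺ lit≥0 {25} *⁺ s
      +⁺ lit≥0 {3} *⁺ (w *⁺ u +⁺ w *⁺ 2m≥10 +⁺ m≥0 *⁺ u)) +⁺ lit≥0 {25} *⁺ (m≥0 *⁺ c)
  arith : ∀ m b δ Δ → + 65 * (+ 75 * (δ - (m - Δ) * (Δ - + 2)) + + 25 * (m * b - + 3 * δ)
        + + 3 * ((+ 4 * m - + 5 * Δ) * (+ 5 * Δ - + 2 * m) + (+ 4 * m - + 5 * Δ) * (+ 2 * m - + 10)
            + m * (+ 5 * Δ - + 2 * m)))
      + + 25 * (m * (m - + 195 - + 65 * b)) ≡ - (m * (+ 365 * m + + 2925))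
  arith = solve-∀
  negative : X < 0ℤ
  negative = subst (_< 0ℤ) (sym (arith m b δ Δ))
      (neg-mono-< (pos-pos m>0 (+-mono-≤-< (lit≥0 {365} *⁺ m≥0) lit>0)))

-- The expression does not increase with Δ because 55n ≥ 112m, so Δ = 4m/5 is the critical case.
-- There, for m = 65n/163, its three terms are about 0.96n², -3.30n² and 2n².
final-arithmetic : ∀ {n m Δ} → 0ℤ < m → 0ℤ ≤ + 2 * n - + 5 * m - + 3 → 0ℤ ≤ + 163 * m - + 65 * n →
  + 4 * m ≤ + 5 * Δ →
  ¬ (0ℤ ≤ + 392 * (m * (+ 2 * n - + 5 * m - + 1)) - Δ * (+ 55 * n - + 112 * m) + + 2 * (n * n))
final-arithmetic {n} {m} {Δ} m>0 b a Δ≥ K = <-irrefl refl (≤-<-trans nonneg negative)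
  where
  m≥0 : 0ℤ ≤ m
  m≥0 = <⇒≤ m>0
  n≥0 : 0ℤ ≤ n
  n≥0 = ≥0-cancel {+ 2} lit>0 (subst (0ℤ ≤_) (arith n m) (b +⁺ lit≥0 {5} *⁺ m≥0 +⁺ lit≥0 {3}))
    where
    arith : ∀ n m → + 2 * n - + 5 * m - + 3 + + 5 * m + + 3 ≡ + 2 * n
    arith = solve-∀
  13m≥5n : 0ℤ ≤ + 13 * m - + 5 * n
  13m≥5n = ≥0-cancel {+ 13} lit>0 (subst (0ℤ ≤_) (arith n m) (a +⁺ lit≥0 {6} *⁺ m≥0))
    where
    arith : ∀ n m → + 163 * m - + 65 * n + + 6 * m ≡ + 13 * (+ 13 * m - + 5 * n)
    arith = solve-∀
  55n≥112m : 0ℤ ≤ + 55 * n - + 112 * m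
  55n≥112m = subst (0ℤ ≤_) (arith n m) (lit≥0 {27} *⁺ b +⁺ n≥0 +⁺ lit≥0 {23} *⁺ m≥0 +⁺ lit≥0 {81})
    where
    arith : ∀ n m → + 27 * (+ 2 * n - + 5 * m - + 3) + n + + 23 * m + + 81 ≡ + 55 * n - + 112 * m
    arith = solve-∀
  7m≥ : 0ℤ ≤ + 7 * m - + 392 * (+ 2 * n - + 5 * m - + 1)
  7m≥ = subst (0ℤ ≤_) (arith n m) (lit≥0 {7} *⁺ (lit≥0 {2} *⁺ a +⁺ lit≥0 {65})
      +⁺ lit≥0 {63} *⁺ (b +⁺ lit≥0 {2}))
    where
    arith : ∀ n m → + 7 * (+ 2 * (+ 163 * m - + 65 * n) + + 65) + + 63 * (+ 2 * n - + 5 * m - + 3 + + 2)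
      ≡ + 7 * m - + 392 * (+ 2 * n - + 5 * m - + 1)
    arith = solve-∀
  -- Again a combination of nonnegative products, in which everything cancels except a negative
  -- polynomial in m.
  X : ℤ
  X = + 5 * (+ 392 * (m * (+ 2 * n - + 5 * m - + 1)) - Δ * (+ 55 * n - + 112 * m) + + 2 * (n * n))
    + (+ 5 * Δ - + 4 * m) * (+ 55 * n - + 112 * m)
        + + 5 * (m * (+ 7 * m - + 392 * (+ 2 * n - + 5 * m - + 1)))
    + (+ 13 * m - + 5 * n) * (+ 2 * n) + + 97 * (m * (+ 2 * n - + 5 * m - + 3))
  nonneg : 0ℤ ≤ X
  nonneg = lit≥0 {5} *⁺ K +⁺ diff≥0 Δ≥ *⁺ 55n≥112m +⁺ lit≥0 {5} *⁺ (m≥0 *⁺ 7m≥)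
      +⁺ 13m≥5n *⁺ (lit≥0 {2} *⁺ n≥0) +⁺ lit≥0 {97} *⁺ (m≥0 *⁺ b)
  arith : ∀ n m Δ → + 5 * (+ 392 * (m * (+ 2 * n - + 5 * m - + 1)) - Δ * (+ 55 * n - + 112 * m)
      + + 2 * (n * n))
    + (+ 5 * Δ - + 4 * m) * (+ 55 * n - + 112 * m)
        + + 5 * (m * (+ 7 * m - + 392 * (+ 2 * n - + 5 * m - + 1)))
    + (+ 13 * m - + 5 * n) * (+ 2 * n) + + 97 * (m * (+ 2 * n - + 5 * m - + 3))
        ≡ - (m * (+ 2 * m + + 291))
  arith = solve-∀
  negative : X < 0ℤ
  negative = subst (_< 0ℤ) (sym (arith n m Δ))
      (neg-mono-< (pos-pos m>0 (+-mono-≤-< (lit≥0 {2} *⁺ m≥0) lit>0)))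

-- Counting triangles and common non-neighbours

module RainbowFree {n : ℕ} (m : ℤ) (χ : Fin n → Fin n → Fin n → ℤ)
  (binary : ∀ k x y → Binary (χ k x y))
  (symmetric : ∀ k x y → χ k x y ≡ χ k y x)
  (irreflexive : ∀ k x → χ k x x ≡ 0ℤ)
  (total : ∀ k → ∑[ x < n ] degree (χ k) x ≡ + 2 * m)
  (unique : ∀ k l x y → χ k x y ≡ 1ℤ → χ l x y ≡ 1ℤ → k ≡ l)
  (no-rainbow : ∀ k l p x y w → χ k x y ≡ 1ℤ → χ l x w ≡ 1ℤ → χ p y w ≡ 1ℤ → k ≡ l ⊎ k ≡ p ⊎ l ≡ p)
  where

  N : ℤ
  N = + n

  -- H is 1 on the diagonal.
  A H : Fin n → Fin n → ℤ
  A x y = ∑[ k < n ] χ k x y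
  H x y = 1ℤ - A x y

  A-cases : ∀ x y → A x y ≡ 0ℤ ⊎ (A x y ≡ 1ℤ × ∃ λ k → χ k x y ≡ 1ℤ)
  A-cases x y = ∑-binary-unique (λ k → χ k x y) (λ k → binary k x y) (λ k l → unique k l x y)

  A-binary : ∀ x y → Binary (A x y)
  A-binary x y with A-cases x y
  ... | inj₁ p = inj₁ p
  ... | inj₂ (p , _) = inj₂ p

  A-symmetric : ∀ x y → A x y ≡ A y x
  A-symmetric x y = sum-cong-≗ (λ k → symmetric k x y)

  A≥0 : ∀ x y → 0ℤ ≤ A x y
  A≥0 x y = binary≥0 (A-binary x y)

  H≥0 : ∀ x y → 0ℤ ≤ H x y
  H≥0 x y = diff≥0 (binary≤1 (A-binary x y))

  H≤1 : ∀ x y → H x y ≤ 1ℤ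
  H≤1 x y = ≤-by (A≥0 x y) (cancel (A x y))
    where
    cancel : ∀ a → a ≡ 1ℤ - (1ℤ - a)
    cancel = solve-∀

  χ≥0 : ∀ k x y → 0ℤ ≤ χ k x y
  χ≥0 k x y = binary≥0 (binary k x y)

  d : Fin n → ℤ
  d = degree A

  ∑d : sum d ≡ N * (+ 2 * m)
  ∑d = trans (∑-rotate (λ x y k → χ k x y)) (trans (sum-cong-≗ total) (∑-const n (+ 2 * m)))

  monochromatic : Fin n → Fin n → Fin n → Fin n → ℤ
  monochromatic k v x y = χ k v x * χ k v y * A x y

  monochromatic≥0 : ∀ k v x y → 0ℤ ≤ monochromatic k v x y
  monochromatic≥0 k v x y = χ≥0 k v x *⁺ χ≥0 k v y *⁺ A≥0 x y

  R : Fin n → Fin n → Fin n → ℤ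
  R v x y = ∑[ k < n ] monochromatic k v x y

  R≥0 : ∀ v x y → 0ℤ ≤ R v x y
  R≥0 v x y = ∑≥0 (λ k → monochromatic≥0 k v x y)

  R≥1 : ∀ k v x y → χ k v x ≡ 1ℤ → χ k v y ≡ 1ℤ → A x y ≡ 1ℤ → 1ℤ ≤ R v x y
  R≥1 k v x y p q r = subst (_≤ R v x y) (cong₂ _*_ (cong₂ _*_ p q) r)
      (term≤∑ (λ j → monochromatic≥0 j v x y) k)

  -- All counts are over ordered tuples: Q k is twice the number of closed cherries of colour k,
  -- triangles is six times the number of triangles, and I below counts each pair twice.
  Q : Fin n → ℤ
  Q k = ∑[ v < n ] ∑[ x < n ] ∑[ y < n ] monochromatic k v x y

  triangles : ℤ
  triangles = ∑[ x < n ] ∑[ y < n ] ∑[ w < n ] (A x y * (A x w * A y w))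

  R-cyclic≥0 : ∀ x y w → 0ℤ ≤ R x y w + R y x w + R w x y
  R-cyclic≥0 x y w = R≥0 x y w +⁺ R≥0 y x w +⁺ R≥0 w x y

  -- Two edges of a triangle that is not rainbow share a colour, and they meet in one of its
  -- vertices. The three terms on the right stand for the three possible centres.
  triangle-cherry : ∀ x y w → A x y * (A x w * A y w) ≤ R x y w + R y x w + R w x y
  triangle-cherry x y w with A-cases x y | A-cases x w | A-cases y w
  ... | inj₁ p | _ | _ = subst (_≤ R x y w + R y x w + R w x y)
      (sym (trans (cong (_* (A x w * A y w)) p) (*-zeroˡ (A x w * A y w)))) (R-cyclic≥0 x y w)
  ... | inj₂ (p , _) | inj₁ q | _ = subst (_≤ R x y w + R y x w + R w x y)
      (sym (trans (cong (A x y *_) (trans (cong (_* A y w) q) (*-zeroˡ (A y w)))) (*-zeroʳ (A x y))))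
          (R-cyclic≥0 x y w)
  ... | inj₂ (p , _) | inj₂ (q , _) | inj₁ r =
      subst (_≤ R x y w + R y x w + R w x y)
          (sym (trans (cong (A x y *_) (trans (cong (A x w *_) r) (*-zeroʳ (A x w))))
              (*-zeroʳ (A x y)))) (R-cyclic≥0 x y w)
  ... | inj₂ (p , k , s) | inj₂ (q , l , t) | inj₂ (r , j , u) =
      subst (_≤ R x y w + R y x w + R w x y) (sym (cong₂ _*_ p (cong₂ _*_ q r))) bound
    where
    bound : 1ℤ ≤ R x y w + R y x w + R w x y
    bound with no-rainbow k l j x y w s t u
    ... | inj₁ refl = +-mono-≤ (+-mono-≤ (R≥1 k x y w s t r) (R≥0 y x w)) (R≥0 w x y)
    ... | inj₂ (inj₁ refl) = +-mono-≤ (+-mono-≤ (R≥0 x y w)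
        (R≥1 k y x w (trans (symmetric k y x) s) u q)) (R≥0 w x y)
    ... | inj₂ (inj₂ refl) = +-mono-≤ (+-mono-≤ (R≥0 x y w) (R≥0 y x w))
        (R≥1 l w x y (trans (symmetric l w x) t) (trans (symmetric l w y) u) p)

  ∑R : ∑[ v < n ] ∑[ x < n ] ∑[ y < n ] R v x y ≡ sum Q
  ∑R = trans (sum-cong-≗ (λ v → ∑-rotate (λ x y k → monochromatic k v x y)))
             (∑-comm (λ v k → ∑[ x < n ] ∑[ y < n ] monochromatic k v x y))

  -- Sum `triangle-cherry` over all ordered triples. After renaming the variables, each choice of
  -- centre contributes the same sum.
  triangles≤ : triangles ≤ + 3 * sum Q
  triangles≤ = subst (triangles ≤_) evaluate
      (∑-mono (λ x → ∑-mono (λ y → ∑-mono (λ w → triangle-cherry x y w))))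
    where
    W = ∑[ v < n ] ∑[ x < n ] ∑[ y < n ] R v x y
    triple : ∀ a → a + a + a ≡ + 3 * a
    triple = solve-∀
    split : ∑[ x < n ] ∑[ y < n ] ∑[ w < n ] (R x y w + R y x w + R w x y)
      ≡ W + ∑[ x < n ] ∑[ y < n ] ∑[ w < n ] R y x w + ∑[ x < n ] ∑[ y < n ] ∑[ w < n ] R w x y
    split =
      trans (sum-cong-≗ (λ x →
        trans (sum-cong-≗ (λ y → sum₃ (R x y) (R y x) (λ w → R w x y)))
              (sum₃ (λ y → sum (R x y)) (λ y → sum (R y x)) (λ y → ∑[ w < n ] R w x y))))
        (sum₃ (λ x → ∑[ y < n ] sum (R x y)) (λ x → ∑[ y < n ] sum (R y x))
            (λ x → ∑[ y < n ] ∑[ w < n ] R w x y))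
      where
      sum₃ : ∀ (f g h : Fin n → ℤ) → ∑[ i < n ] (f i + g i + h i) ≡ sum f + sum g + sum h
      sum₃ f g h = trans (∑-distrib-+ (λ i → f i + g i) h) (cong (_+ sum h) (∑-distrib-+ f g))
    evaluate : ∑[ x < n ] ∑[ y < n ] ∑[ w < n ] (R x y w + R y x w + R w x y) ≡ + 3 * sum Q
    evaluate = trans split
      (trans (cong₂ (λ a b → W + a + b) (∑-comm (λ x y → sum (R y x))) (∑-rotate (λ x y w → R w x y)))
      (trans (triple W) (cong (_*_ (+ 3)) ∑R)))

  -- The number of common non-neighbours. For adjacent x and y the diagonal entries of `H` do no
  -- harm: w = x and w = y contribute 0, because the other factor vanishes.
  C : Fin n → Fin n → ℤ
  C x y = ∑[ w < n ] (H x w * H y w)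

  C≥0 : ∀ x y → 0ℤ ≤ C x y
  C≥0 x y = ∑≥0 (λ w → H≥0 x w *⁺ H≥0 y w)

  C≤N : ∀ x y → C x y ≤ N
  C≤N x y = subst (C x y ≤_) (trans (∑-const n 1ℤ) (*-identityʳ N)) (∑-mono (λ w →
    ≤-by (diff≥0 (H≤1 x w) +⁺ H≥0 x w *⁺ diff≥0 (H≤1 y w)) (arith (H x w) (H y w))))
    where
    arith : ∀ a b → (1ℤ - a) + a * (1ℤ - b) ≡ 1ℤ - a * b
    arith = solve-∀

  I : ℤ
  I = ∑[ x < n ] ∑[ y < n ] (A x y * C x y)

  I≥0 : 0ℤ ≤ I
  I≥0 = ∑≥0 (λ x → ∑≥0 (λ y → A≥0 x y *⁺ C≥0 x y))

  D₂ : ℤ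
  D₂ = ∑[ x < n ] (d x * d x)

  -- Goodman's identity, by inclusion-exclusion: an edge `xy` has `N - d x - d y` common
  -- non-neighbours plus as many as it has common neighbours.
  I-identity : I ≡ N * sum d - D₂ - D₂ + triangles
  I-identity =
    trans (sum-cong-≗ rows)
    (trans (∑-alternating (λ x → N * d x) (λ x → d x * d x) (λ x → ∑[ y < n ] (A x y * d y))
             (λ x → ∑[ y < n ] ∑[ w < n ] (A x y * (A x w * A y w))))
      (cong₂ (λ a b → a - D₂ - b + triangles) (∑-*ˡ N d) columns))
    where
    expand : ∀ a b → (1ℤ - a) * (1ℤ - b) ≡ 1ℤ - a - b + a * b
    expand = solve-∀
    distribute : ∀ a n d e b → a * (n - d - e + b) ≡ n * a - d * a - a * e + a * b
    distribute = solve-∀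
    C-identity : ∀ x y → C x y ≡ N - d x - d y + ∑[ w < n ] (A x w * A y w)
    C-identity x y =
      trans (sum-cong-≗ (λ w → expand (A x w) (A y w)))
      (trans (∑-alternating (λ _ → 1ℤ) (A x) (A y) (λ w → A x w * A y w))
        (cong (λ t → t - d x - d y + ∑[ w < n ] (A x w * A y w))
            (trans (∑-const n 1ℤ) (*-identityʳ N))))
    rows : ∀ x → ∑[ y < n ] (A x y * C x y)
      ≡ N * d x - d x * d x - ∑[ y < n ] (A x y * d y) + ∑[ y < n ] ∑[ w < n ] (A x y * (A x w * A y w))
    rows x =
      trans (sum-cong-≗ (λ y → trans (cong (A x y *_) (C-identity x y))
          (distribute (A x y) N (d x) (d y) (B y))))
      (trans (∑-alternating (λ y → N * A x y) (λ y → d x * A x y) (λ y → A x y * d y)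
          (λ y → A x y * B y))
      (trans (cong₂ (λ a b → a - b - ∑[ y < n ] (A x y * d y) + ∑[ y < n ] (A x y * B y)) (∑-*ˡ N (A x))
          (∑-*ˡ (d x) (A x)))
        (cong (λ t → N * d x - d x * d x - ∑[ y < n ] (A x y * d y) + t)
          (sum-cong-≗ (λ y → sym (∑-*ˡ (A x y) (λ w → A x w * A y w)))))))
      where
      B : Fin n → ℤ
      B y = ∑[ w < n ] (A x w * A y w)
    columns : ∑[ x < n ] ∑[ y < n ] (A x y * d y) ≡ D₂
    columns = trans (∑-comm (λ x y → A x y * d y))
      (sum-cong-≗ (λ y → trans (∑-*ʳ (d y) (λ x → A x y))
          (cong (_* d y) (sum-cong-≗ (λ x → A-symmetric x y)))))

  -- Degree variance and the deficits of the colours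

  deviation : Fin n → ℤ
  deviation x = (d x - + 2 * m) * (d x - + 2 * m)

  V : ℤ
  V = sum deviation

  V≥0 : 0ℤ ≤ V
  V≥0 = ∑≥0 (λ x → square≥0 (d x - + 2 * m))

  V-identity : V ≡ D₂ - + 2 * m * sum d - + 2 * m * sum d + N * (+ 2 * m * (+ 2 * m))
  V-identity =
    trans (sum-cong-≗ (λ x → expand (d x) (+ 2 * m)))
    (trans (∑-alternating (λ x → d x * d x) (λ x → + 2 * m * d x) (λ x → + 2 * m * d x)
        (λ _ → + 2 * m * (+ 2 * m)))
      (cong₂ (λ a b → D₂ - a - a + b) (∑-*ˡ (+ 2 * m) d) (∑-const n (+ 2 * m * (+ 2 * m)))))
    where
    expand : ∀ a b → (a - b) * (a - b) ≡ a * a - b * a - b * a + b * b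
    expand = solve-∀

  -- As m(m - 1) is twice the number of pairs of edges in the class, this is twice the number of
  -- pairs that do not form a closed cherry.
  deficit : Fin n → ℤ
  deficit k = m * (m - 1ℤ) - Q k

  -- Adding `2V` to `I` cancels the sum of squared degrees, whose coefficient in Goodman's identity
  -- is -2. What is left of `I` is the triangle count, to which `triangles≤` applies.
  total-deficit : I + + 2 * V + + 3 * sum deficit ≤ N * m * (+ 2 * N - + 5 * m - + 3)
  total-deficit = ≤-by (diff≥0 triangles≤)
    (trans (arith N m D₂ triangles (sum Q))
      (sym (cong₂ (λ a b → N * m * (+ 2 * N - + 5 * m - + 3) - (a + b))
        (cong₂ (λ a b → a + + 2 * b)
          (trans I-identity (cong (λ s → N * s - D₂ - D₂ + triangles) ∑d))
          (trans V-identity (cong (λ s → D₂ - + 2 * m * s - + 2 * m * s + N * (+ 2 * m * (+ 2 * m)))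
              ∑d)))
        (cong (_*_ (+ 3)) (trans (∑-- (λ _ → m * (m - 1ℤ)) Q)
            (cong (_- sum Q) (∑-const n (m * (m - 1ℤ)))))))))
    where
    arith : ∀ n m d t q → + 3 * q - t ≡ n * m * (+ 2 * n - + 5 * m - + 3) -
      ((n * (n * (+ 2 * m)) - d - d + t + + 2 *
          (d - + 2 * m * (n * (+ 2 * m)) - + 2 * m * (n * (+ 2 * m)) + n * (+ 2 * m * (+ 2 * m))))
       + + 3 * (n * (m * (m - 1ℤ)) - q))
    arith = solve-∀

  budget : ℤ
  budget = N * m * (+ 2 * N - + 5 * m - + 3)

  -- Some colour has at most the average deficit. `I` and `V` do not depend on the colour, so they
  -- keep their full weight.
  cheap-colour : 0ℤ < N → ∃ λ k → I + + 2 * V + + 3 * (N * deficit k) ≤ budget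
  cheap-colour N>0 = finish (∃-positive-term slack
      (subst (0ℤ <_) (sym evaluate) (+-mono-<-≤ N>0 total-slack)))
    where
    c : ℤ
    c = budget - (I + + 2 * V)
    -- The summand 1 turns a nonnegative total into a positive one, as `∃-positive-term` requires.
    -- Over the integers, `0ℤ < 1ℤ + a` gives back `0ℤ ≤ a`.
    slack : Fin n → ℤ
    slack k = 1ℤ + (c - + 3 * N * deficit k)
    evaluate : sum slack ≡ N + (N * c - + 3 * N * sum deficit)
    evaluate = trans (∑-distrib-+ (λ _ → 1ℤ) (λ k → c - + 3 * N * deficit k))
      (cong₂ _+_ (trans (∑-const n 1ℤ) (*-identityʳ N))
        (trans (∑-- (λ _ → c) (λ k → + 3 * N * deficit k))
            (cong₂ _-_ (∑-const n c) (∑-*ˡ (+ 3 * N) deficit))))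
    total-slack : 0ℤ ≤ N * c - + 3 * N * sum deficit
    total-slack = subst (0ℤ ≤_) (factor N budget I V (sum deficit)) (<⇒≤ N>0 *⁺ diff≥0 total-deficit)
      where
      factor : ∀ n b i v s → n * (b - (i + + 2 * v + + 3 * s)) ≡ n * (b - (i + + 2 * v)) - + 3 * n * s
      factor = solve-∀
    0<1+a⇒0≤a : ∀ {a} → 0ℤ < 1ℤ + a → 0ℤ ≤ a
    0<1+a⇒0≤a {+ a} _ = lit≥0
    0<1+a⇒0≤a { -[1+ zero ]} (+<+ ())
    finish : (∃ λ k → 0ℤ < slack k) → ∃ λ k → I + + 2 * V + + 3 * (N * deficit k) ≤ budget
    finish (k , p) = k , ≤-by (0<1+a⇒0≤a p) (rearrange N budget I V (deficit k))
      where
      rearrange : ∀ n b i v s → b - (i + + 2 * v) - + 3 * n * s ≡ b - (i + + 2 * v + + 3 * (n * s))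
      rearrange = solve-∀

  -- Open cherries and leaf sets of one colour

  module Colour (k : Fin n) where
    open ClassBounds (χ k) m (binary k) (symmetric k) (irreflexive k) (total k) public

    -- The pairs x = y are included, because `H` is 1 on the diagonal. Over all v there are 2m of
    -- them, which explains the term 2m in the estimates below.
    open-pairs : Fin n → ℤ
    open-pairs v = ∑[ x < n ] ∑[ y < n ] (χ k v x * χ k v y * H x y)

    open-pair≥0 : ∀ v x y → 0ℤ ≤ χ k v x * χ k v y * H x y
    open-pair≥0 v x y = χ≥0 k v x *⁺ χ≥0 k v y *⁺ H≥0 x y

    A-irreflexive : ∀ x → A x x ≡ 0ℤ
    A-irreflexive x = ∑-zero (λ j → irreflexive j x)

    e≤open-pairs : ∀ v → e v ≤ open-pairs v
    e≤open-pairs v = ∑-mono (λ x → subst (_≤ ∑[ y < n ] (χ k v x * χ k v y * H x y)) (diagonal x)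
        (term≤∑ (open-pair≥0 v x) x))
      where
      diagonal : ∀ x → χ k v x * χ k v x * H x x ≡ χ k v x
      diagonal x = trans (cong₂ _*_ (binary-idem (binary k v x)) (cong (_-_ 1ℤ) (A-irreflexive x)))
          (*-identityʳ (χ k v x))

    ∑open-pairs : sum open-pairs ≡ squares - Q k
    ∑open-pairs =
      trans (sum-cong-≗ (λ v →
        trans (sum-cong-≗ (λ x →
          trans (sum-cong-≗ (λ y → split (χ k v x * χ k v y) (A x y)))
                (∑-- (λ y → χ k v x * χ k v y) (monochromatic k v x))))
        (trans (∑-- (λ x → ∑[ y < n ] (χ k v x * χ k v y)) (λ x → sum (monochromatic k v x)))
          (cong (_- ∑[ x < n ] ∑[ y < n ] monochromatic k v x y) (∑∑-* (χ k v) (χ k v))))))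
      (∑-- (λ v → e v * e v) (λ v → ∑[ x < n ] ∑[ y < n ] monochromatic k v x y))
      where
      split : ∀ a b → a * (1ℤ - b) ≡ a - a * b
      split = solve-∀

    2m≤∑open-pairs : + 2 * m ≤ squares - Q k
    2m≤∑open-pairs = subst₂ _≤_ (total k) ∑open-pairs (∑-mono e≤open-pairs)

    -- Of the at most m(m + 1) pairs counted by `squares`, 2m have x = y, so at most m(m - 1) are
    -- closed.
    deficit≥0 : 0ℤ ≤ deficit k
    deficit≥0 = subst (0ℤ ≤_) (arith m squares (Q k)) (diff≥0 2m≤∑open-pairs +⁺ diff≥0 squares≤)
      where
      arith : ∀ m s q → (s - q - + 2 * m) + (m * (m + 1ℤ) - s) ≡ m * (m - 1ℤ) - q
      arith = solve-∀

    squares≥ : m * (m + 1ℤ) - deficit k ≤ squares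
    squares≥ = ≤-by (diff≥0 2m≤∑open-pairs) (arith m squares (Q k))
      where
      arith : ∀ m s q → s - q - + 2 * m ≡ s - (m * (m + 1ℤ) - (m * (m - 1ℤ) - q))
      arith = solve-∀

    -- The open pairs at a single vertex are at most those at all vertices together.
    open-pairs≤ : ∀ v → open-pairs v ≤ + 2 * m + deficit k
    open-pairs≤ v = ≤-trans (term≤∑ (λ u → ∑≥0 (λ x → ∑≥0 (open-pair≥0 u x))) v)
      (subst (_≤ + 2 * m + deficit k) (sym ∑open-pairs)
          (≤-by (diff≥0 squares≤) (arith m squares (Q k))))
      where
      arith : ∀ m s q → m * (m + 1ℤ) - s ≡ + 2 * m + (m * (m - 1ℤ) - q) - (s - q)
      arith = solve-∀

    module Star (v : Fin n) where
      -- The indicator of the leaf set L of the star at v.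
      ℓ : Fin n → ℤ
      ℓ = χ k v

      ℓ≥0 : ∀ x → 0ℤ ≤ ℓ x
      ℓ≥0 = χ≥0 k v

      ℓ≤1 : ∀ x → ℓ x ≤ 1ℤ
      ℓ≤1 x = binary≤1 (binary k v x)

      h : Fin n → ℤ
      h w = ∑[ x < n ] (ℓ x * H x w)

      h² : ℤ
      h² = ∑[ w < n ] (h w * h w)

      -- Both sides count the triples (x, y, w) with x and y in L and w a common non-neighbour.
      h²-identity : h² ≡ ∑[ x < n ] ∑[ y < n ] (ℓ x * ℓ y * C x y)
      h²-identity =
        trans (sum-cong-≗ (λ w → sym (∑∑-* (λ x → ℓ x * H x w) (λ y → ℓ y * H y w))))
        (trans (sym (∑-rotate (λ x y w → ℓ x * H x w * (ℓ y * H y w))))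
        (sum-cong-≗ (λ x → sum-cong-≗ (λ y →
          trans (sum-cong-≗ (λ w → regroup (ℓ x) (H x w) (ℓ y) (H y w)))
              (∑-*ˡ (ℓ x * ℓ y) (λ w → H x w * H y w))))))
        where
        regroup : ∀ a b c d → a * b * (c * d) ≡ a * c * (b * d)
        regroup = solve-∀

      -- Adjacent pairs in L are among those counted by `I`. Each of the other pairs is open and has
      -- at most `N` common non-neighbours.
      h²≤ : h² ≤ I + N * open-pairs v
      h²≤ = subst₂ _≤_ (sym h²-identity) evaluate (∑-mono (λ x → ∑-mono (λ y →
        ≤-by ((diff≥0 (ℓℓ≤1 x y) *⁺ (A≥0 x y *⁺ C≥0 x y)) +⁺ open-pair≥0 v x y *⁺ diff≥0 (C≤N x y))
             (arith (ℓ x) (ℓ y) (A x y) (C x y) N))))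
        where
        ℓℓ≤1 : ∀ x y → ℓ x * ℓ y ≤ 1ℤ
        ℓℓ≤1 x y = ≤-by (diff≥0 (ℓ≤1 x) +⁺ ℓ≥0 x *⁺ diff≥0 (ℓ≤1 y)) (unit (ℓ x) (ℓ y))
          where
          unit : ∀ a b → (1ℤ - a) + a * (1ℤ - b) ≡ 1ℤ - a * b
          unit = solve-∀
        arith : ∀ p q a c n → (1ℤ - p * q) * (a * c) + p * q * (1ℤ - a) * (n - c)
            ≡ a * c + n * (p * q * (1ℤ - a)) - p * q * c
        arith = solve-∀
        evaluate : ∑[ x < n ] ∑[ y < n ] (A x y * C x y + N * (ℓ x * ℓ y * H x y))
            ≡ I + N * open-pairs v
        evaluate =
          trans (sum-cong-≗ (λ x → trans (∑-distrib-+ (λ y → A x y * C x y)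
              (λ y → N * (ℓ x * ℓ y * H x y)))
            (cong (_+_ (∑[ y < n ] (A x y * C x y))) (∑-*ˡ N (λ y → ℓ x * ℓ y * H x y)))))
          (trans (∑-distrib-+ (λ x → ∑[ y < n ] (A x y * C x y))
              (λ x → N * (∑[ y < n ] (ℓ x * ℓ y * H x y))))
            (cong (_+_ I) (∑-*ˡ N (λ x → ∑[ y < n ] (ℓ x * ℓ y * H x y)))))

      ℓd : ℤ
      ℓd = ∑[ x < n ] (ℓ x * d x)

      ∑h : sum h ≡ N * e v - ℓd
      ∑h =
        trans (∑-comm (λ w x → ℓ x * H x w))
        (trans (sum-cong-≗ (λ x → trans (∑-*ˡ (ℓ x) (H x))
          (trans (cong (_*_ (ℓ x)) (trans (∑-- (λ _ → 1ℤ) (A x))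
              (cong (_- d x) (trans (∑-const n 1ℤ) (*-identityʳ N)))))
            (distribute (ℓ x) N (d x)))))
        (trans (∑-- (λ x → N * ℓ x) (λ x → ℓ x * d x)) (cong (_- ℓd) (∑-*ˡ N ℓ))))
        where
        distribute : ∀ a n d → a * (n - d) ≡ n * a - a * d
        distribute = solve-∀

      -- h is compared with n/14, a value near its mean, which is about 2n/25.
      h²≥ : 0ℤ ≤ + 196 * h² - + 28 * (N * sum h) + N * (N * N)
      h²≥ = subst (0ℤ ≤_) evaluate (∑≥0 (λ w → square≥0 (+ 14 * h w - N)))
        where
        expand : ∀ a n → (+ 14 * a - n) * (+ 14 * a - n)
            ≡ + 196 * (a * a) - + 14 * n * a - + 14 * n * a + n * n
        expand = solve-∀
        collect : ∀ a n s t → + 196 * a - + 14 * n * s - + 14 * n * s + t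
            ≡ + 196 * a - + 28 * (n * s) + t
        collect = solve-∀
        evaluate : ∑[ w < n ] ((+ 14 * h w - N) * (+ 14 * h w - N))
            ≡ + 196 * h² - + 28 * (N * sum h) + N * (N * N)
        evaluate =
          trans (sum-cong-≗ (λ w → expand (h w) N))
          (trans (∑-alternating (λ w → + 196 * (h w * h w)) (λ w → + 14 * N * h w)
              (λ w → + 14 * N * h w) (λ _ → N * N))
          (trans (cong₂ (λ a b → a - b - b + ∑[ w < n ] (N * N)) (∑-*ˡ (+ 196) (λ w → h w * h w))
              (∑-*ˡ (+ 14 * N) h))
          (trans (cong (_+_ (+ 196 * h² - + 14 * N * sum h - + 14 * N * sum h)) (∑-const n (N * N)))
            (collect h² N (sum h) (N * (N * N))))))

      ℓ-deviation : ℤ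
      ℓ-deviation = ∑[ x < n ] (ℓ x * deviation x)

      ℓ-deviation≤ : ℓ-deviation ≤ V
      ℓ-deviation≤ = ∑-mono (λ x → ≤-by (diff≥0 (ℓ≤1 x) *⁺ square≥0 (d x - + 2 * m))
          (arith (ℓ x) (deviation x)))
        where
        arith : ∀ a b → (1ℤ - a) * b ≡ b - a * b
        arith = solve-∀

      -- The scale n/28 gives V the coefficient 784 = 2·392, its weight relative to I in cheap-colour.
      ℓd≤ : 0ℤ ≤ + 784 * ℓ-deviation - + 56 * (N * ℓd) + (+ 112 * (N * m) + N * N) * e v
      ℓd≤ = subst (0ℤ ≤_) evaluate (∑≥0 (λ x → ℓ≥0 x *⁺ square≥0 (+ 28 * (d x - + 2 * m) - N)))
        where
        expand : ∀ l d m n → l * ((+ 28 * (d - + 2 * m) - n) * (+ 28 * (d - + 2 * m) - n))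
          ≡ + 784 * (l * ((d - + 2 * m) * (d - + 2 * m))) - + 28 * n * (l * d) - + 28 * n * (l * d)
              + (+ 112 * (n * m) + n * n) * l
        expand = solve-∀
        collect : ∀ a n s t → + 784 * a - + 28 * n * s - + 28 * n * s + t
            ≡ + 784 * a - + 56 * (n * s) + t
        collect = solve-∀
        evaluate : ∑[ x < n ] (ℓ x * ((+ 28 * (d x - + 2 * m) - N) * (+ 28 * (d x - + 2 * m) - N)))
          ≡ + 784 * ℓ-deviation - + 56 * (N * ℓd) + (+ 112 * (N * m) + N * N) * e v
        evaluate =
          trans (sum-cong-≗ (λ x → expand (ℓ x) (d x) m N))
          (trans (∑-alternating (λ x → + 784 * (ℓ x * deviation x)) (λ x → + 28 * N * (ℓ x * d x))
              (λ x → + 28 * N * (ℓ x * d x)) (λ x → (+ 112 * (N * m) + N * N) * ℓ x))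
          (trans (cong₂ (λ a b → a - b - b + ∑[ x < n ] ((+ 112 * (N * m) + N * N) * ℓ x))
              (∑-*ˡ (+ 784) (λ x → ℓ x * deviation x)) (∑-*ˡ (+ 28 * N) (λ x → ℓ x * d x)))
          (trans (cong (_+_ (+ 784 * ℓ-deviation - + 28 * N * ℓd - + 28 * N * ℓd))
              (∑-*ˡ (+ 112 * (N * m) + N * N) ℓ))
            (collect ℓ-deviation N ℓd ((+ 112 * (N * m) + N * N) * e v)))))

      -- The weights eliminate `h²`, `ℓd`, `ℓ-deviation`, `I`, `V`, the open pairs and the deficit,
      -- leaving only the degree of v. The result is a multiple of `N`, which is then divided out.
      star-bound : 0ℤ < N → I + + 2 * V + + 3 * (N * deficit k) ≤ budget →
        0ℤ ≤ + 392 * (m * (+ 2 * N - + 5 * m - + 1)) - e v * (+ 55 * N - + 112 * m) + + 2 * (N * N)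
      star-bound N>0 cheap = ≥0-cancel N>0
          (subst (0ℤ ≤_) (arith N m h² I V (deficit k) ℓ-deviation (open-pairs v) ℓd (e v))
        (lit≥0 {2} *⁺ subst (λ s → 0ℤ ≤ + 196 * h² - + 28 * (N * s) + N * (N * N)) ∑h h²≥
          +⁺ ℓd≤
          +⁺ lit≥0 {392} *⁺ (diff≥0 h²≤ +⁺ N≥0 *⁺ diff≥0 (open-pairs≤ v))
          +⁺ lit≥0 {784} *⁺ diff≥0 ℓ-deviation≤
          +⁺ lit≥0 {392} *⁺ (diff≥0 cheap +⁺ lit≥0 {2} *⁺ (N≥0 *⁺ deficit≥0))))
        where
        N≥0 : 0ℤ ≤ N
        N≥0 = <⇒≤ N>0
        arith : ∀ n m h i v δ u p l e →
          + 2 * (+ 196 * h - + 28 * (n * (n * e - l)) + n * (n * n))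
          + (+ 784 * u - + 56 * (n * l) + (+ 112 * (n * m) + n * n) * e)
          + + 392 * ((i + n * p - h) + n * (+ 2 * m + δ - p))
          + + 784 * (v - u)
          + + 392 * ((n * m * (+ 2 * n - + 5 * m - + 3) - (i + + 2 * v + + 3 * (n * δ)))
              + + 2 * (n * δ))
          ≡ n * (+ 392 * (m * (+ 2 * n - + 5 * m - + 1)) - e * (+ 55 * n - + 112 * m) + + 2 * (n * n))
        arith = solve-∀

    -- The degrees sum to 2m and their squares to nearly m², since the deficit is small. Weighted by
    -- itself, the degree therefore averages about m/2, which exceeds 2m/5.
    large-star : 0ℤ < m → 0ℤ ≤ m - + 195 - + 65 * (+ 2 * N - + 5 * m - + 3) →
      0ℤ ≤ m * (+ 2 * N - + 5 * m - + 3) - + 3 * deficit k →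
      ∃ λ v → 0ℤ ≤ + 5 * e v - + 2 * m
    large-star m>0 c s = finish (∃-positive-term (λ v → e v * (+ 5 * e v - + 2 * m))
        (subst (0ℤ <_) (sym evaluate) positive-sum))
      where
      expand : ∀ a m → a * (+ 5 * a - + 2 * m) ≡ + 5 * (a * a) - + 2 * m * a
      expand = solve-∀
      evaluate : ∑[ v < n ] (e v * (+ 5 * e v - + 2 * m)) ≡ + 5 * squares - + 2 * m * (+ 2 * m)
      evaluate =
        trans (sum-cong-≗ (λ v → expand (e v) m))
        (trans (∑-- (λ v → + 5 * (e v * e v)) (λ v → + 2 * m * e v))
          (cong₂ _-_ (∑-*ˡ (+ 5) (λ v → e v * e v))
              (trans (∑-*ˡ (+ 2 * m) e) (cong (_*_ (+ 2 * m)) (total k)))))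
      arith : ∀ m b δ s → + 39 * (+ 5 * s - + 2 * m * (+ 2 * m)) ≡
        m * (+ 38 * m + + 390) + m * (m - + 195 - + 65 * b) + + 65 * (m * b - + 3 * δ)
            + + 195 * (s - (m * (m + 1ℤ) - δ))
      arith = solve-∀
      m≥0 : 0ℤ ≤ m
      m≥0 = <⇒≤ m>0
      positive-sum : 0ℤ < + 5 * squares - + 2 * m * (+ 2 * m)
      positive-sum = >0-cancel (lit≥0 {39})
          (subst (0ℤ <_) (sym (arith m (+ 2 * N - + 5 * m - + 3) (deficit k) squares))
        (+-mono-<-≤ (+-mono-<-≤ (+-mono-<-≤ (pos-pos m>0 (+-mono-≤-< (lit≥0 {38} *⁺ m≥0) lit>0))
          (m≥0 *⁺ c)) (lit≥0 {65} *⁺ s)) (lit≥0 {195} *⁺ diff≥0 squares≥)))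
      finish : (∃ λ v → 0ℤ < e v * (+ 5 * e v - + 2 * m)) → ∃ λ v → 0ℤ ≤ + 5 * e v - + 2 * m
      finish (v , p) = v , <⇒≤ (>0-cancel (e≥0 v) p)

  contradiction : 0ℤ < N → 0ℤ ≤ + 163 * m - + 65 * N → ⊥
  contradiction N>0 a = uncurry refute (cheap-colour N>0)
    where
    refute : ∀ k → I + + 2 * V + + 3 * (N * deficit k) ≤ budget → ⊥
    refute k cheap = finish (large-star m>0 c s)
      where
      open Colour k
      m>0 : 0ℤ < m
      m>0 = >0-cancel (lit≥0 {163}) (<-≤-trans (pos-pos (lit>0 {64}) N>0) (0≤i-j⇒j≤i a))
      b : ℤ
      b = + 2 * N - + 5 * m - + 3
      s : 0ℤ ≤ m * b - + 3 * deficit k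
      s = ≥0-cancel N>0 (subst (0ℤ ≤_) (arith N m b I V (deficit k))
          (diff≥0 cheap +⁺ I≥0 +⁺ lit≥0 {2} *⁺ V≥0))
        where
        arith : ∀ n m b i v δ → n * m * b - (i + + 2 * v + + 3 * (n * δ)) + i + + 2 * v
            ≡ n * (m * b - + 3 * δ)
        arith = solve-∀
      -- No upper bound on m is assumed: were b negative, the budget could not cover the nonnegative
      -- defects.
      b≥0 : 0ℤ ≤ b
      b≥0 = ≥0-cancel m>0 (subst (0ℤ ≤_) (arith (m * b) (deficit k)) (s +⁺ lit≥0 {3} *⁺ deficit≥0))
        where
        arith : ∀ a δ → a - + 3 * δ + + 3 * δ ≡ a
        arith = solve-∀
      c : 0ℤ ≤ m - + 195 - + 65 * b
      c = diff≥0 (large-class {N} {m} a)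
      finish : (∃ λ v → 0ℤ ≤ + 5 * e v - + 2 * m) → ⊥
      -- The degree of v is first raised from 2m/5 to 4m/5, since the small deficit excludes the
      -- values between. Only then is it large enough to contradict `star-bound`.
      finish (v , u) = final-arithmetic {N} {m} m>0 b≥0 a
        (star-arithmetic m>0 c s b≥0 u (subst (0ℤ ≤_)
            (arith (m * (m + 1ℤ)) ((m - e v) * (e v - + 2)) (deficit k) squares)
          (diff≥0 squares≥ +⁺ diff≥0 (squares≤star v))))
        (Star.star-bound v N>0 cheap)
        where
        arith : ∀ a t δ s → (s - (a - δ)) + (a - t - s) ≡ δ - t
        arith = solve-∀

-- Incidence matrices of truncated colour classes

joins : ∀ {n} → Fin n × Fin n → Fin n → Fin n → ℤ
joins (a , b) x y = δ a x * δ b y + δ a y * δ b x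

-- As a sum over the list, the matrix has total 2·`length T` by linearity alone. That its entries
-- are 0 or 1 is shown separately, in `incidence-cases`.
incidence : ∀ {n} → List (Fin n × Fin n) → Fin n → Fin n → ℤ
incidence [] x y = 0ℤ
incidence (p ∷ T) x y = joins p x y + incidence T x y

incidence-symmetric : ∀ {n} (T : List (Fin n × Fin n)) x y → incidence T x y ≡ incidence T y x
incidence-symmetric [] x y = refl
incidence-symmetric ((a , b) ∷ T) x y =
    cong₂ _+_ (+-comm (δ a x * δ b y) (δ a y * δ b x)) (incidence-symmetric T x y)

incidence-total : ∀ {n} (T : List (Fin n × Fin n)) → ∑[ x < n ] degree (incidence T) x
    ≡ + 2 * + length T
incidence-total {n} [] = ∑-zero {f = degree {n} (incidence [])}
    (λ x → ∑-zero {n} {incidence [] x} (λ y → refl))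
incidence-total {n} (p@(a , b) ∷ T) =
  trans (sum-cong-≗ (λ x → ∑-distrib-+ (joins p x) (incidence T x)))
  (trans (∑-distrib-+ (degree (joins p)) (degree (incidence T)))
  (trans (cong₂ _+_ pair (incidence-total T)) (sym (*-suc (+ 2) (+ length T)))))
  where
  ∑δ : ∀ i → sum (δ {n} i) ≡ 1ℤ
  ∑δ i = trans (sum-cong-≗ (λ j → sym (*-identityʳ (δ i j)))) (∑-δ i (λ _ → 1ℤ))
  product : ∀ i j → ∑[ x < n ] ∑[ y < n ] (δ i x * δ j y) ≡ 1ℤ
  product i j = trans (∑∑-* (δ i) (δ j)) (cong₂ _*_ (∑δ i) (∑δ j))
  pair : ∑[ x < n ] degree (joins p) x ≡ + 2
  pair = trans (sum-cong-≗ (λ x → ∑-distrib-+ (λ y → δ a x * δ b y) (λ y → δ a y * δ b x)))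
    (trans (∑-distrib-+ (λ x → ∑[ y < n ] (δ a x * δ b y)) (λ x → ∑[ y < n ] (δ a y * δ b x)))
      (cong₂ _+_ (product a b) (trans (∑-comm (λ x y → δ a y * δ b x)) (product a b))))

Ordered : ∀ {n} → Fin n × Fin n → Set
Ordered (a , b) = toℕ a ℕ.< toℕ b

joins-cases : ∀ {n} {p : Fin n × Fin n} → Ordered p → ∀ x y →
  joins p x y ≡ 0ℤ ⊎ (joins p x y ≡ 1ℤ × (p ≡ (x , y) ⊎ p ≡ (y , x)))
joins-cases {p = a , b} a<b x y with a ≟ x | b ≟ y | a ≟ y | b ≟ x
... | yes refl | yes refl | yes refl | _ = ⊥-elim (ℕ.<-irrefl refl a<b)
... | yes refl | yes refl | no q | _ rewrite δ-diag a | δ-diag b | δ-off q = inj₂ (refl , inj₁ refl)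
... | yes refl | no p | _ | yes refl = ⊥-elim (ℕ.<-irrefl refl a<b)
... | yes refl | no p | _ | no q rewrite δ-off p | δ-off q | *-zeroʳ (δ a a) | *-zeroʳ (δ a y) =
    inj₁ refl
... | no p | _ | yes refl | yes refl rewrite δ-off p | δ-diag a | δ-diag b = inj₂ (refl , inj₂ refl)
... | no p | _ | yes refl | no q rewrite δ-off p | δ-off q | *-zeroʳ (δ a a) = inj₁ refl
... | no p | _ | no q | _ rewrite δ-off p | δ-off q = inj₁ refl

-- Two pairs in the list that contribute to the same entry are equal or reversed. `Unique` excludes
-- the first and `Ordered` the second.
incidence-cases : ∀ {n} {T : List (Fin n × Fin n)} → Unique T → All Ordered T → ∀ x y →
  incidence T x y ≡ 0ℤ ⊎ (incidence T x y ≡ 1ℤ × ((x , y) ∈ T ⊎ (y , x) ∈ T))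
incidence-cases [] [] x y = inj₁ refl
incidence-cases {T = p ∷ T} (p∉T ∷ unique) (p< ∷ ordered) x y
  with joins-cases p< x y | incidence-cases unique ordered x y
... | inj₁ q | inj₁ r = inj₁ (cong₂ _+_ q r)
... | inj₁ q | inj₂ (r , s) = inj₂ (cong₂ _+_ q r , ⊎-map there there s)
... | inj₂ (q , s) | inj₁ r = inj₂ (cong₂ _+_ q r , ⊎-map (here ∘ sym) (here ∘ sym) s)
... | inj₂ (_ , inj₁ refl) | inj₂ (_ , inj₁ s) = ⊥-elim (All.lookup p∉T s refl)
... | inj₂ (_ , inj₁ refl) | inj₂ (_ , inj₂ s) = ⊥-elim (ℕ.<-asym p< (All.lookup ordered s))
... | inj₂ (_ , inj₂ refl) | inj₂ (_ , inj₁ s) = ⊥-elim (ℕ.<-asym p< (All.lookup ordered s))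
... | inj₂ (_ , inj₂ refl) | inj₂ (_ , inj₂ s) = ⊥-elim (All.lookup p∉T s refl)

-- The search is finite, so the theorem may be proved by contradiction.
rainbow-triangle? : ∀ {n} {G : SimpleGraph n} (f : EdgeColoring G) → Dec (RainbowTriangle f)
rainbow-triangle? {G = G} f = any? λ a → any? λ b → any? λ c →
  (Adj G a b Bool.≟ true) ×-dec (Adj G b c Bool.≟ true) ×-dec (Adj G a c Bool.≟ true) ×-dec
  ¬? (col f a b ℕ.≟ col f b c) ×-dec ¬? (col f b c ℕ.≟ col f a c) ×-dec ¬? (col f a b ℕ.≟ col f a c)

module Truncation {n : ℕ} {G : SimpleGraph n} (f : EdgeColoring G) (cls : Fin n → ℕ)
  (injective : Injective _≡_ _≡_ cls) (m : ℕ) (m≤ : ∀ k → m ℕ.≤ classSize f (cls k)) where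

  Coloured : ℕ → Fin n × Fin n → Set
  Coloured c p = col f (proj₁ p) (proj₂ p) ≡ c

  class : Fin n → List (Fin n × Fin n)
  class k = filter (λ p → col f (proj₁ p) (proj₂ p) ℕ.≟ cls k) (edges G)

  truncated : Fin n → List (Fin n × Fin n)
  truncated k = take m (class k)

  χ : Fin n → Fin n → Fin n → ℤ
  χ k = incidence (truncated k)

  truncated-length : ∀ k → length (truncated k) ≡ m
  truncated-length k = trans (length-take m (class k)) (ℕ.m≤n⇒m⊓n≡m (m≤ k))

  truncated-unique : ∀ k → Unique (truncated k)
  truncated-unique k = Unique.take⁺ m (Unique.filter⁺ _ (Unique.filter⁺ _
    (Unique.cartesianProduct⁺ (Unique.allFin⁺ n) (Unique.allFin⁺ n))))

  truncated-edges : ∀ k → All (λ p → Ordered p × Adj G (proj₁ p) (proj₂ p) ≡ true) (truncated k)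
  truncated-edges k = All.take⁺ m (All.filter⁺ _
      (All.all-filter _ (cartesianProduct (allFin n) (allFin n))))

  truncated-coloured : ∀ k → All (Coloured (cls k)) (truncated k)
  truncated-coloured k = All.take⁺ m (All.all-filter _ (edges G))

  χ-cases : ∀ k x y → χ k x y ≡ 0ℤ ⊎ (χ k x y ≡ 1ℤ × ((x , y) ∈ truncated k ⊎ (y , x) ∈ truncated k))
  χ-cases k = incidence-cases (truncated-unique k) (All.map proj₁ (truncated-edges k))

  χ-binary : ∀ k x y → Binary (χ k x y)
  χ-binary k x y = ⊎-map id proj₁ (χ-cases k x y)

  χ-irreflexive : ∀ k x → χ k x x ≡ 0ℤ
  χ-irreflexive k x with χ-cases k x x
  ... | inj₁ p = p
  ... | inj₂ (_ , inj₁ q) = ⊥-elim (ℕ.<-irrefl refl (proj₁ (All.lookup (truncated-edges k) q)))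
  ... | inj₂ (_ , inj₂ q) = ⊥-elim (ℕ.<-irrefl refl (proj₁ (All.lookup (truncated-edges k) q)))

  χ-total : ∀ k → ∑[ x < n ] degree (χ k) x ≡ + 2 * + m
  χ-total k = trans (incidence-total (truncated k)) (cong (λ l → + 2 * + l) (truncated-length k))

  χ-edge : ∀ k x y → χ k x y ≡ 1ℤ → Adj G x y ≡ true × col f x y ≡ cls k
  χ-edge k x y p with χ-cases k x y
  ... | inj₁ q with trans (sym p) q
  ...   | ()
  χ-edge k x y p | inj₂ (_ , inj₁ q) =
      proj₂ (All.lookup (truncated-edges k) q) , All.lookup (truncated-coloured k) q
  χ-edge k x y p | inj₂ (_ , inj₂ q) =
      -- The pair is listed in reverse, and colours are symmetric only on edges, so adjacency has to
      -- come first.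
      adjacent , trans (col-sym f x y adjacent) (All.lookup (truncated-coloured k) q)
    where
    adjacent : Adj G x y ≡ true
    adjacent = trans (SimpleGraph.sym G x y) (proj₂ (All.lookup (truncated-edges k) q))

  χ-unique : ∀ k l x y → χ k x y ≡ 1ℤ → χ l x y ≡ 1ℤ → k ≡ l
  χ-unique k l x y p q = injective (trans (sym (proj₂ (χ-edge k x y p))) (proj₂ (χ-edge l x y q)))

  χ-no-rainbow : ¬ RainbowTriangle f → ∀ k l j x y w → χ k x y ≡ 1ℤ → χ l x w ≡ 1ℤ → χ j y w ≡ 1ℤ →
    k ≡ l ⊎ k ≡ j ⊎ l ≡ j
  χ-no-rainbow none k l j x y w p q r with k ≟ l | k ≟ j | l ≟ j
  ... | yes k≡l | _ | _ = inj₁ k≡l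
  ... | no _ | yes k≡j | _ = inj₂ (inj₁ k≡j)
  ... | no _ | no _ | yes l≡j = inj₂ (inj₂ l≡j)
  ... | no k≢l | no k≢j | no l≢j with χ-edge k x y p | χ-edge l x w q | χ-edge j y w r
  ...   | xy , cxy | xw , cxw | yw , cyw =
      ⊥-elim (none (x , y , w , xy , yw , xw , distinct k≢j cxy cyw , distinct (l≢j ∘ sym) cyw cxw ,
          distinct k≢l cxy cxw))
    where
    distinct : ∀ {i j c d} → i ≢ j → c ≡ cls i → d ≡ cls j → c ≢ d
    distinct i≢j c≡ d≡ c≡d = i≢j (injective (trans (sym c≡) (trans c≡d d≡)))

-- The common class size

least-multiple : ∀ a b t → a ℕ.≤ b ℕ.* t → ∃ λ m → a ℕ.≤ b ℕ.* m × (∀ s → a ℕ.≤ b ℕ.* s → m ℕ.≤ s)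
least-multiple a b zero p = zero , p , λ _ _ → ℕ.z≤n
least-multiple a b (suc t) p with a ℕ.≤? b ℕ.* t
... | yes q = least-multiple a b t q
-- Failure at t rules out every s ≤ t by monotonicity, so `suc t` is least.
... | no q = suc t , p , λ s r → ℕ.≰⇒> (λ s≤t → q (ℕ.≤-trans r (ℕ.*-monoʳ-≤ b s≤t)))

-- The condition says p/q ≤ c/d, so a lower bound of c/d on s/n weakens to p/q.
relax-ratio : ∀ c d p q .{{_ : NonZero c}} → p ℕ.* d ℕ.≤ c ℕ.* q → ∀ n s → c ℕ.* n ℕ.≤ d ℕ.* s →
    p ℕ.* n ℕ.≤ q ℕ.* s
relax-ratio c d p q pd≤cq n s cn≤ds = ℕ.*-cancelˡ-≤ c (begin
  c ℕ.* (p ℕ.* n)  ≡⟨ exchange c p n ⟩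
  p ℕ.* (c ℕ.* n)  ≤⟨ ℕ.*-monoʳ-≤ p cn≤ds ⟩
  p ℕ.* (d ℕ.* s)  ≡⟨ ℕ.*-assoc p d s ⟨
  p ℕ.* d ℕ.* s    ≤⟨ ℕ.*-monoˡ-≤ s pd≤cq ⟩
  c ℕ.* q ℕ.* s    ≡⟨ ℕ.*-assoc c q s ⟩
  c ℕ.* (q ℕ.* s)  ∎)
  where
  open ℕ.≤-Reasoning
  exchange : ∀ a b c → a ℕ.* (b ℕ.* c) ≡ b ℕ.* (a ℕ.* c)
  exchange a b c = trans (sym (ℕ.*-assoc a b c))
      (trans (cong (ℕ._* c) (ℕ.*-comm a b)) (ℕ.*-assoc b a c))

theorem1p5 : (n : ℕ) → 1 ℕ.≤ n → (G : SimpleGraph n) → (f : EdgeColoring G) →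
    (cls : Fin n → ℕ) → Injective _≡_ _≡_ cls →
    (∀ k → 3988 ℕ.* n ℕ.≤ 10000 ℕ.* classSize f (cls k)) →
    RainbowTriangle f
theorem1p5 (suc n) _ G f cls injective large = decidable-stable (rainbow-triangle? f) λ none →
  -- The first class, present because n ≥ 1, bounds the search for m. Minimality then puts m below
  -- the size of every class, so all of them can be truncated to m edges.
  refute none (least-multiple (65 ℕ.* suc n) 163 (classSize f (cls zero)) (size zero))
  where
  -- 65/163 is a convergent of 0.3988, just below it.
  size : ∀ k → 65 ℕ.* suc n ℕ.≤ 163 ℕ.* classSize f (cls k)
  size k = relax-ratio 3988 10000 65 163 (ℕ.≤ᵇ⇒≤ 650000 650044 tt) (suc n) (classSize f (cls k))
      (large k)
  refute : ¬ RainbowTriangle f →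
    ¬ (∃ λ m → 65 ℕ.* suc n ℕ.≤ 163 ℕ.* m × (∀ s → 65 ℕ.* suc n ℕ.≤ 163 ℕ.* s → m ℕ.≤ s))
  refute none (m , 65n≤163m , least) =
    RainbowFree.contradiction (+ m) χ χ-binary (λ k → incidence-symmetric (truncated k)) χ-irreflexive
        χ-total χ-unique (χ-no-rainbow none)
      lit>0 (diff≥0 (subst₂ _≤_ (pos-* 65 (suc n)) (pos-* 163 m) (+≤+ 65n≤163m)))
    where open Truncation f cls injective m (λ k → least (classSize f (cls k)) (size k))
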